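{- Let $m\geq2$. Then $\mathbb{E}^{12\cdots m}(L_n)\sim m-1$ as $n\to\infty$, i.e. the expected length of a longest increasing subsequence of a uniformly random permutation in $S_n(312,12\cdots m)$ tends to $m-1$.
   Context: $S_n(312,\tau)$ is the set of permutations of $[n]$ avoiding both patterns $312$ and $\tau$; $12\cdots m$ is the increasing permutation of length $m$. $L_n(\sigma)$ is the length of a longest increasing subsequence of $\sigma$, and $\mathbb{E}^{\tau}$ denotes expectation under the uniform distribution on $S_n(312,\tau)$. $a_n\sim b_n$ means $a_n/b_n\to1$. -}

module Defs where

open import Data.Bool using (Bool; true; false; _∧_; if_then_else_)
open import Data.Nat using (ℕ; zero; suc; _<ᵇ_; _⊔_)
open import Data.List using (List; []; _∷_; map; _++_; concatMap; length; filter; upTo; foldr)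
open import Data.Bool.ListAction using (any)
open import Data.Nat.ListAction using (sum)
open import Data.List.Relation.Unary.Unique.Propositional using (Unique)
open import Data.List.Relation.Unary.Unique.Propositional.Properties using ()
open import Data.List.Relation.Unary.Unique.DecPropositional using (unique?)
import Data.Nat.Properties as ℕP
open import Data.Integer using (+_)
open import Data.Rational using (ℚ; 0ℚ; _/_; _*_)
open import Data.Fin using (Fin)
open import Data.Fin.Base using (toℕ)
import Data.List.Relation.Unary.Unique.DecPropositional as UD

-- A permutation of [n] is represented in one-line notation as a list of
-- length n of the values 0,…,n-1 (0-indexed), without repetition.

words : ℕ → ℕ → List (List ℕ)
words n zero    = [] ∷ []
words n (suc k) = concatMap (λ w → map (_∷ w) (upTo n)) (words n k)

perms : ℕ → List (List ℕ)
perms n = filter (UD.unique? ℕP._≟_) (words n n)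

subseqs : List ℕ → List (List ℕ)
subseqs []       = [] ∷ []
subseqs (x ∷ xs) = map (x ∷_) (subseqs xs) ++ subseqs xs

_==ᵇ_ : Bool → Bool → Bool
true  ==ᵇ b = b
false ==ᵇ true  = false
false ==ᵇ false = true

sameCmp : ℕ → List ℕ → ℕ → List ℕ → Bool
sameCmp x []       p []       = true
sameCmp x (y ∷ ys) p (q ∷ qs) = ((x <ᵇ y) ==ᵇ (p <ᵇ q)) ∧ ((y <ᵇ x) ==ᵇ (q <ᵇ p)) ∧ sameCmp x ys p qs
sameCmp x _        p _        = false

orderIso : List ℕ → List ℕ → Bool
orderIso []       []       = true
orderIso (x ∷ xs) (p ∷ ps) = sameCmp x xs p ps ∧ orderIso xs ps
orderIso _        _        = false

contains : List ℕ → List ℕ → Bool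
contains π σ = any (λ s → orderIso s π) (subseqs σ)

avoids : List ℕ → List ℕ → Bool
avoids π σ = if contains π σ then false else true

-- the patterns 312 and 12⋯m (values shifted to start at 0)
p312 : List ℕ
p312 = 2 ∷ 0 ∷ 1 ∷ []

incr : ℕ → List ℕ
incr m = upTo m

S312 : ℕ → List ℕ → List (List ℕ)
S312 n τ = filter (λ σ → Data.Bool._≟_ (avoids p312 σ ∧ avoids τ σ) true) (perms n)
  where import Data.Bool

increasing : List ℕ → Bool
increasing []           = true
increasing (x ∷ [])     = true
increasing (x ∷ y ∷ xs) = (x <ᵇ y) ∧ increasing (y ∷ xs)

maxList : List ℕ → ℕ
maxList = foldr _⊔_ 0

LIS : List ℕ → ℕ
LIS σ = maxList (map length (filter (λ s → Data.Bool._≟_ (increasing s) true) (subseqs σ)))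
  where import Data.Bool

-- division of a rational by a natural number (the 0 case is never used)
divℕ : ℚ → ℕ → ℚ
divℕ q zero    = 0ℚ
divℕ q (suc d) = q * ((+ 1) / suc d)

-- E^τ(L_n): average of L_n over S_n(312, τ)  (S_n(312,τ) is never empty)
expLIS : List ℕ → ℕ → ℚ
expLIS τ n = divℕ ((+ sum (map LIS (S312 n τ))) / 1) (length (S312 n τ))

{-# OPTIONS --safe #-}
-- Write M = m - 1.  On S(312, 12⋯m) the length L is at most M, so it suffices that the
-- permutations with L < M have vanishing proportion.  A 312-avoiding permutation of
-- {0,…,n} is p ++ d with d the decreasing tail that starts at the maximum n.  Inserting
-- n + 1 keeps it 312-avoiding exactly when what follows n + 1 is a suffix of d; the length L
-- is unchanged if that suffix is all of d, and grows by 1 otherwise.  Let g n q be the number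
-- of these permutations with L = q + 1 and W n q the sum of their |d|.  Then
--   g (n+1) (q+1) = g n (q+1) + W n q,   g n q + W n q ≤ W (n+1) q,   W n q ≤ (n+1) g n q,
-- which gives g n q ≤ (n+1)^(2q) and g n q ≥ h^(2q) for n ≥ 2qh.  Hence g n q has order
-- n^(2q), and the permutations with L = M outnumber the others by a factor of order n².
module Submission where

open import Defs
open import Data.Nat using (ℕ; _≤_; _∸_)
open import Data.Integer using (+_)
open import Data.Rational using (ℚ; _<_; _-_; ∣_∣; 0ℚ; 1ℚ; _/_)
open import Data.Product using (∃; Σ)

open import Data.Bool as Bool using (true; false; T; _∧_)
open import Data.Bool.Properties using (T-≡; T-∧)
open import Data.Empty using (⊥; ⊥-elim)
open import Data.Integer as ℤ using (-[1+_]; +<+)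
import Data.Integer.Properties as ℤ
open import Data.List
  using (List; []; _∷_; [_]; _++_; map; concatMap; length; filter; upTo; downFrom)
import Data.List.Properties as List
open import Data.List.Membership.Propositional using (_∈_; find; lose)
open import Data.List.Membership.Propositional.Properties
open import Data.List.Relation.Binary.Disjoint.Propositional using (Disjoint)
open import Data.List.Relation.Binary.Permutation.Propositional
  using (_↭_; ↭-refl; ↭-sym; ↭-trans; prep; ↭⇒↭ₛ)
open import Data.List.Relation.Binary.Permutation.Propositional.Properties
  using (∈-resp-↭; ↭-length; ↭-singleton-inv; shift; drop-∷)
open import Relation.Binary.PropositionalEquality.Properties using (setoid)
open import Data.List.Relation.Binary.Permutation.Setoid.Properties (setoid ℕ) using (Unique-resp-↭)
open import Data.List.Relation.Binary.Pointwise using (Pointwise; []; _∷_)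
open import Data.List.Relation.Binary.Sublist.Propositional
  using (_⊆_; []; _∷ʳ_; _∷_; ⊆-refl; ⊆-trans; minimum; from∈)
open import Data.List.Relation.Binary.Sublist.Propositional.Properties
  using (All-resp-⊆; take-⊆; ++⁺ˡ; ++⁺ʳ) renaming (++⁺ to ⊆-++⁺)
open import Data.List.Relation.Unary.All as All using (All; []; _∷_)
import Data.List.Relation.Unary.All.Properties as All
open import Data.List.Relation.Unary.AllPairs as AllPairs using (AllPairs; []; _∷_)
import Data.List.Relation.Unary.AllPairs.Properties as AllPairs
open import Data.List.Relation.Unary.Any as Any using (Any; here; there)
open import Data.List.Relation.Unary.Any.Properties using (any⁺; any⁻)
open import Data.List.Relation.Unary.Linked using (Linked; []; [-]; _∷_)
open import Data.List.Relation.Unary.Linked.Properties using (Linked⇒AllPairs)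
open import Data.List.Relation.Unary.Unique.Propositional using (Unique)
import Data.List.Relation.Unary.Unique.Propositional.Properties as Unique
open import Data.List.Relation.Unary.Unique.DecPropositional using (unique?)
open import Data.Nat using (zero; suc; _+_; _*_; _^_; _>_; z≤n; s≤s; _<ᵇ_; _≤?_)
  renaming (_<_ to _<ₙ_)
open import Data.Nat.ListAction using (sum)
open import Data.Nat.ListAction.Properties using (sum-++)
import Data.Nat.DivMod as ℕ using (_/_; _%_; m≡m%n+[m/n]*n; m%n<n; m/n*n≤m; m≥n⇒m/n>0)
open import Data.Nat.Properties as ℕ using (≤-refl; ≤-trans; module ≤-Reasoning)
open import Data.Product using (∃₂; _×_; _,_; proj₁; proj₂)
open import Data.Rational as ℚ using (mkℚ; toℚᵘ)
import Data.Rational.Properties as ℚ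
open import Data.Rational.Unnormalised as ℚᵘ using (mkℚᵘ; *<*)
import Data.Rational.Unnormalised.Properties as ℚᵘ
open import Data.Sum using (_⊎_; inj₁; inj₂)
open import Function using (_∘_; id)
open import Function.Bundles using (Equivalence)
open import Level using (Level)
open import Relation.Binary using (Rel)
open import Relation.Binary.PropositionalEquality
  using (_≡_; _≢_; refl; sym; trans; cong; cong₂; subst; subst₂; module ≡-Reasoning)
open import Relation.Nullary using (¬_; yes; no)

private
  variable
    a ℓ : Level
    A B : Set a
    n q : ℕ
    s t xs ys : List A
    R : Rel A ℓ

Increasing Decreasing : List ℕ → Set
Increasing = AllPairs _<ₙ_
Decreasing = AllPairs _>_

<ᵇ-true : ∀ {m n} → m <ₙ n → (m <ᵇ n) ≡ true
<ᵇ-true m<n = Equivalence.to T-≡ (ℕ.<⇒<ᵇ m<n)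

<ᵇ-false : ∀ {m n} → m <ₙ n → (n <ᵇ m) ≡ false
<ᵇ-false {m} {n} m<n with n <ᵇ m in eq
... | false = refl
... | true  = ⊥-elim (ℕ.<-asym m<n (ℕ.<ᵇ⇒< n m (subst T (sym eq) _)))

-- Lists

AllPairs-resp-⊆ : s ⊆ t → AllPairs R t → AllPairs R s
AllPairs-resp-⊆ []         []       = []
AllPairs-resp-⊆ (_ ∷ʳ p)   (_ ∷ ts) = AllPairs-resp-⊆ p ts
AllPairs-resp-⊆ (refl ∷ p) (t ∷ ts) = All-resp-⊆ p t ∷ AllPairs-resp-⊆ p ts

⊆-++⁻ : ∀ xs → s ⊆ xs ++ ys → ∃₂ λ s₁ s₂ → s ≡ s₁ ++ s₂ × s₁ ⊆ xs × s₂ ⊆ ys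
⊆-++⁻ []       p = [] , _ , refl , [] , p
⊆-++⁻ (x ∷ xs) (_ ∷ʳ p) with ⊆-++⁻ xs p
... | s₁ , s₂ , eq , p₁ , p₂ = s₁ , s₂ , eq , x ∷ʳ p₁ , p₂
⊆-++⁻ (x ∷ xs) (refl ∷ p) with ⊆-++⁻ xs p
... | s₁ , s₂ , eq , p₁ , p₂ = x ∷ s₁ , s₂ , cong (x ∷_) eq , refl ∷ p₁ , p₂

-- Each entry of `xs` is removed from `ys` in turn; since `xs` has no repetition, the removal of `x`
-- keeps the rest of `xs` inside what remains. The complement `zs` serves both length comparison and
-- pigeonhole.
Unique∧⊆⇒↭ : Unique xs → (∀ {x} → x ∈ xs → x ∈ ys) → ∃ λ zs → ys ↭ xs ++ zs
Unique∧⊆⇒↭ {ys = ys} [] _ = ys , ↭-refl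
Unique∧⊆⇒↭ {xs = x ∷ xs} (x∉xs ∷ u) sub with ∈-∃++ (sub (here refl))
... | ys₁ , ys₂ , refl with Unique∧⊆⇒↭ {ys = ys₁ ++ ys₂} u sub′
  where
  sub′ : ∀ {y} → y ∈ xs → y ∈ ys₁ ++ ys₂
  sub′ y∈xs with ∈-resp-↭ (shift x ys₁ ys₂) (sub (there y∈xs))
  ... | here refl = ⊥-elim (All.lookup x∉xs y∈xs refl)
  ... | there y∈  = y∈
... | zs , perm = zs , ↭-trans (shift x ys₁ ys₂) (prep x perm)

Unique∧⊆⇒length≤ : Unique xs → (∀ {x} → x ∈ xs → x ∈ ys) → length xs ≤ length ys
Unique∧⊆⇒length≤ {xs = xs} u sub with Unique∧⊆⇒↭ u sub
... | zs , perm rewrite ↭-length perm | List.length-++ xs {zs} = ℕ.m≤m+n _ _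

length-concatMap : (f : A → List B) (xs : List A) → length (concatMap f xs) ≡ sum (map (length ∘ f) xs)
length-concatMap f []       = refl
length-concatMap f (x ∷ xs) = trans (List.length-++ (f x))
  (cong (_+_ (length (f x))) (length-concatMap f xs))

-- Permutations

words⁺ : ∀ {n} k {w} → length w ≡ k → All (_<ₙ n) w → w ∈ words n k
words⁺ zero    {[]}    refl []       = here refl
words⁺ (suc k) {x ∷ w} refl (x< ∷ w<) =
  ∈-concatMap⁺ (λ w → map (_∷ w) (upTo _))
    (Any.map (λ { refl → ∈-map⁺ (_∷ w) (∈-upTo⁺ x<) }) (words⁺ k refl w<))

words⁻ : ∀ {n} k {w} → w ∈ words n k → length w ≡ k × All (_<ₙ n) w
words⁻ zero (here refl) = refl , []
words⁻ {n} (suc k) w∈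
  with w′ , w′∈ , w∈map ← find (∈-concatMap⁻ (λ w → map (_∷ w) (upTo n)) {xs = words n k} w∈)
  with x , x∈ , refl ← ∈-map⁻ (_∷ w′) w∈map
  with len , w< ← words⁻ k w′∈ = cong suc len , ∈-upTo⁻ x∈ ∷ w<

words-Unique : ∀ n k → Unique (words n k)
words-Unique n zero    = [] ∷ []
words-Unique n (suc k) = Unique.concat⁺
  (All.map⁺ (All.universal (λ w → Unique.map⁺ List.∷-injectiveˡ (Unique.upTo⁺ n)) (words n k)))
  (AllPairs.map⁺ (AllPairs.map disjoint (words-Unique n k)))
  where
  disjoint : ∀ {w w′} → w ≢ w′ → Disjoint (map (_∷ w) (upTo n)) (map (_∷ w′) (upTo n))
  disjoint w≢w′ (v∈ , v∈′)
    with _ , _ , refl ← ∈-map⁻ _ v∈ with _ , _ , eq ← ∈-map⁻ _ v∈′ = w≢w′ (List.∷-injectiveʳ eq)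

-- `downFrom (suc n)` computes to `n ∷ downFrom n`, so inserting or deleting the maximum is one
-- `shift` and one head step.
IsPerm : ℕ → List ℕ → Set
IsPerm n σ = σ ↭ downFrom n

perms-Unique : ∀ n → Unique (perms n)
perms-Unique n = Unique.filter⁺ (unique? ℕ._≟_) (words-Unique n n)

perms⁺ : IsPerm n xs → xs ∈ perms n
perms⁺ {n} {xs} p = ∈-filter⁺ (unique? ℕ._≟_)
  (words⁺ n (trans (↭-length p) (List.length-downFrom n))
    (All.tabulate (λ x∈ → ∈-downFrom⁻ (∈-resp-↭ p x∈))))
  (Unique-resp-↭ (↭⇒↭ₛ (↭-sym p)) (Unique.downFrom⁺ n))

-- Pigeonhole: the distinct entries below `n` have a complement `zs` in `downFrom n`, and equal
-- lengths force it to be empty.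
perms⁻ : xs ∈ perms n → IsPerm n xs
perms⁻ {xs} {n} xs∈ with ∈-filter⁻ (unique? ℕ._≟_) xs∈
... | xs∈words , u with words⁻ n xs∈words
... | len , xs< with Unique∧⊆⇒↭ u (∈-downFrom⁺ ∘ All.lookup xs<)
... | [] , p = ↭-sym (subst (downFrom n ↭_) (List.++-identityʳ xs) p)
... | z ∷ zs , p = ⊥-elim (ℕ.<-irrefl eq (ℕ.m<m+n (length xs) (s≤s z≤n)))
  where
  eq : length xs ≡ length xs + length (z ∷ zs)
  eq = trans len (trans (sym (List.length-downFrom n)) (trans (↭-length p) (List.length-++ xs)))

perm-insert : ∀ xs → IsPerm n (xs ++ ys) → IsPerm (suc n) (xs ++ n ∷ ys)
perm-insert {n} xs p = ↭-trans (shift n xs _) (prep n p)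

perm-delete : ∀ xs → IsPerm (suc n) (xs ++ n ∷ ys) → IsPerm n (xs ++ ys)
perm-delete {n} xs p = drop-∷ (↭-trans (↭-sym (shift n xs _)) p)

perm-< : IsPerm n xs → All (_<ₙ n) xs
perm-< p = All.tabulate (∈-downFrom⁻ ∘ ∈-resp-↭ p)

perm-length : IsPerm n xs → length xs ≡ n
perm-length {n} p = trans (↭-length p) (List.length-downFrom n)

-- Subsequences and patterns

∈-subseqs⁺ : s ⊆ xs → s ∈ subseqs xs
∈-subseqs⁺ []         = here refl
∈-subseqs⁺ (x ∷ʳ p)   = ∈-++⁺ʳ (map (x ∷_) _) (∈-subseqs⁺ p)
∈-subseqs⁺ (refl ∷ p) = ∈-++⁺ˡ (∈-map⁺ _ (∈-subseqs⁺ p))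

∈-subseqs⁻ : s ∈ subseqs xs → s ⊆ xs
∈-subseqs⁻ {xs = []}     (here refl) = []
∈-subseqs⁻ {xs = x ∷ xs} s∈ with ∈-++⁻ (map (x ∷_) (subseqs xs)) s∈
... | inj₂ s∈′ = x ∷ʳ ∈-subseqs⁻ s∈′
... | inj₁ s∈′ with _ , t∈ , refl ← ∈-map⁻ _ s∈′ = refl ∷ ∈-subseqs⁻ t∈

avoids⁺ : ∀ π σ → (∀ {s} → s ⊆ σ → ¬ T (orderIso s π)) → T (avoids π σ)
avoids⁺ π σ av with contains π σ in eq
... | false = _
... | true with s , s∈ , iso ← find (any⁻ (λ s → orderIso s π) (subseqs σ) (subst T (sym eq) _))
  = av (∈-subseqs⁻ s∈) iso

avoids⁻ : ∀ π σ → T (avoids π σ) → s ⊆ σ → ¬ T (orderIso s π)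
avoids⁻ π σ av s⊆σ iso with contains π σ | any⁺ (λ s → orderIso s π) (lose (∈-subseqs⁺ s⊆σ) iso)
... | true | _ = av

Avoids312 : List ℕ → Set
Avoids312 σ = ∀ {a b c} → a ∷ b ∷ c ∷ [] ⊆ σ → b <ₙ c → c <ₙ a → ⊥

orderIso-p312⁺ : ∀ {a b c} → b <ₙ c → c <ₙ a → T (orderIso (a ∷ b ∷ c ∷ []) p312)
orderIso-p312⁺ {a} {b} {c} b<c c<a
  rewrite <ᵇ-true b<c | <ᵇ-true c<a | <ᵇ-true (ℕ.<-trans b<c c<a)
        | <ᵇ-false b<c | <ᵇ-false c<a | <ᵇ-false (ℕ.<-trans b<c c<a) = _

sameCmp⁻ : ∀ x xs p ps → T (sameCmp x xs p ps) →
  Pointwise (λ y q → (x <ᵇ y) ≡ (p <ᵇ q) × (y <ᵇ x) ≡ (q <ᵇ p)) xs ps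
sameCmp⁻ x []       p []       _ = []
sameCmp⁻ x (y ∷ ys) p (q ∷ qs) h
  with e₁ , h₁ ← Equivalence.to T-∧ h
  with e₂ , h₂ ← Equivalence.to T-∧ h₁ = (==ᵇ⁻ _ _ e₁ , ==ᵇ⁻ _ _ e₂) ∷ sameCmp⁻ x ys p qs h₂
  where
  ==ᵇ⁻ : ∀ b c → T (b ==ᵇ c) → b ≡ c
  ==ᵇ⁻ true  true  _ = refl
  ==ᵇ⁻ false false _ = refl

avoids-p312⁺ : ∀ σ → Avoids312 σ → T (avoids p312 σ)
avoids-p312⁺ σ av = avoids⁺ p312 σ go
  where
  go : ∀ {s} → s ⊆ σ → ¬ T (orderIso s p312)
  go {a ∷ b ∷ c ∷ []} s⊆σ iso
    with h₁ , h₂ ← Equivalence.to (T-∧ {sameCmp a (b ∷ c ∷ []) 2 (0 ∷ 1 ∷ [])}) iso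
    with h₃ , _ ← Equivalence.to (T-∧ {sameCmp b (c ∷ []) 0 (1 ∷ [])}) h₂
    with _ ∷ (_ , c<a) ∷ [] ← sameCmp⁻ a (b ∷ c ∷ []) 2 (0 ∷ 1 ∷ []) h₁
    with (b<c , _) ∷ [] ← sameCmp⁻ b (c ∷ []) 0 (1 ∷ []) h₃
    = av s⊆σ (ℕ.<ᵇ⇒< b c (subst T (sym b<c) _)) (ℕ.<ᵇ⇒< c a (subst T (sym c<a) _))
  -- For length two or above three the test does not reduce to `false`, being a blocked conjunction;
  -- the `Pointwise` view exposes the length mismatch.
  go {a ∷ b ∷ c ∷ d ∷ s} _ iso
    with h₁ , _ ← Equivalence.to (T-∧ {sameCmp a (b ∷ c ∷ d ∷ s) 2 (0 ∷ 1 ∷ [])}) iso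
    with _ ∷ _ ∷ () ← sameCmp⁻ a (b ∷ c ∷ d ∷ s) 2 (0 ∷ 1 ∷ []) h₁
  go {a ∷ b ∷ []} _ iso
    with h₁ , _ ← Equivalence.to (T-∧ {sameCmp a (b ∷ []) 2 (0 ∷ 1 ∷ [])}) iso
    with _ ∷ () ← sameCmp⁻ a (b ∷ []) 2 (0 ∷ 1 ∷ []) h₁

avoids-p312⁻ : ∀ σ → T (avoids p312 σ) → Avoids312 σ
avoids-p312⁻ σ av s⊆σ b<c c<a = avoids⁻ p312 σ av s⊆σ (orderIso-p312⁺ b<c c<a)

orderIso-increasing⁺ : Increasing xs → Increasing ys → length xs ≡ length ys → T (orderIso xs ys)
orderIso-increasing⁺ []        []        _   = _
orderIso-increasing⁺ (x< ∷ xs) (y< ∷ ys) eq =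
  Equivalence.from T-∧ (go x< y< (ℕ.suc-injective eq) , orderIso-increasing⁺ xs ys (ℕ.suc-injective eq))
  where
  go : ∀ {x y xs ys} → All (x <ₙ_) xs → All (y <ₙ_) ys → length xs ≡ length ys → T (sameCmp x xs y ys)
  go []         []         _  = _
  go (x< ∷ xs<) (y< ∷ ys<) eq
    rewrite <ᵇ-true x< | <ᵇ-false x< | <ᵇ-true y< | <ᵇ-false y< = go xs< ys< (ℕ.suc-injective eq)

orderIso-increasing⁻ : ∀ xs {ys} → T (orderIso xs ys) → Increasing ys →
  Increasing xs × length xs ≡ length ys
orderIso-increasing⁻ []       {[]}     _   []        = [] , refl
orderIso-increasing⁻ (x ∷ xs) {y ∷ ys} iso (y< ∷ ys<)
  with h₁ , h₂ ← Equivalence.to (T-∧ {sameCmp x xs y ys}) iso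
  with xs< , len ← orderIso-increasing⁻ xs h₂ ys<
  = go (sameCmp⁻ x xs y ys h₁) y< ∷ xs< , cong suc len
  where
  go : ∀ {xs ys} → Pointwise (λ u v → (x <ᵇ u) ≡ (y <ᵇ v) × (u <ᵇ x) ≡ (v <ᵇ y)) xs ys →
    All (y <ₙ_) ys → All (x <ₙ_) xs
  go []             []        = []
  go ((e , _) ∷ es) (y< ∷ ys) = ℕ.<ᵇ⇒< _ _ (subst T (sym e) (ℕ.<⇒<ᵇ y<)) ∷ go es ys

upTo-Increasing : ∀ n → Increasing (upTo n)
upTo-Increasing n = AllPairs.applyUpTo⁺₁ id n (λ i<j _ → i<j)

avoids-incr⁺ : ∀ m σ → (∀ {s} → s ⊆ σ → Increasing s → length s <ₙ m) → T (avoids (incr m) σ)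
avoids-incr⁺ m σ short = avoids⁺ (incr m) σ go
  where
  go : ∀ {s} → s ⊆ σ → ¬ T (orderIso s (incr m))
  go {s} s⊆σ iso with s< , len ← orderIso-increasing⁻ s iso (upTo-Increasing m)
    = ℕ.<-irrefl (trans len (List.length-upTo m)) (short s⊆σ s<)

-- A longer increasing subsequence would be cut to its first `m` terms, which already form the
-- pattern.
avoids-incr⁻ : ∀ m σ → T (avoids (incr m) σ) → s ⊆ σ → Increasing s → length s <ₙ m
avoids-incr⁻ {s = s} m σ av s⊆σ s< with m ≤? length s
... | no m≰  = ℕ.≰⇒> m≰
... | yes m≤ = ⊥-elim (avoids⁻ (incr m) σ av (⊆-trans (take-⊆ m s) s⊆σ)
  (orderIso-increasing⁺ (AllPairs-resp-⊆ (take-⊆ m s) s<) (upTo-Increasing m)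
    (trans (List.length-take m s) (trans (ℕ.m≤n⇒m⊓n≡m m≤) (sym (List.length-upTo m))))))

increasing⁺ : Increasing xs → T (increasing xs)
increasing⁺ []                       = _
increasing⁺ ([] ∷ [])                = _
increasing⁺ ((x<y ∷ _) ∷ (y< ∷ ys<)) = Equivalence.from T-∧ (ℕ.<⇒<ᵇ x<y , increasing⁺ (y< ∷ ys<))

increasing⁻ : ∀ xs → T (increasing xs) → Increasing xs
increasing⁻ xs = Linked⇒AllPairs ℕ.<-trans ∘ linked xs
  where
  linked : ∀ xs → T (increasing xs) → Linked _<ₙ_ xs
  linked []           _ = []
  linked (x ∷ [])     _ = [-]
  linked (x ∷ y ∷ xs) h =
    ℕ.<ᵇ⇒< x y (proj₁ (Equivalence.to T-∧ h)) ∷ linked (y ∷ xs) (proj₂ (Equivalence.to (T-∧ {x <ᵇ y}) h))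

∈⇒≤maxList : ∀ {x xs} → x ∈ xs → x ≤ maxList xs
∈⇒≤maxList (here refl) = ℕ.m≤m⊔n _ _
∈⇒≤maxList (there x∈)  = ≤-trans (∈⇒≤maxList x∈) (ℕ.m≤n⊔m _ _)

maxList≤ : ∀ {k xs} → All (_≤ k) xs → maxList xs ≤ k
maxList≤ []        = z≤n
maxList≤ (x ∷ xs≤) = ℕ.⊔-lub x (maxList≤ xs≤)

length≤LIS : s ⊆ xs → Increasing s → length s ≤ LIS xs
length≤LIS s⊆xs s< = ∈⇒≤maxList (∈-map⁺ length
  (∈-filter⁺ (λ s → increasing s Bool.≟ true) (∈-subseqs⁺ s⊆xs) (Equivalence.to T-≡ (increasing⁺ s<))))

LIS≤ : ∀ {k} σ → (∀ {s} → s ⊆ σ → Increasing s → length s ≤ k) → LIS σ ≤ k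
LIS≤ {k} σ bound = maxList≤ (All.map⁺ (All.tabulate go))
  where
  go : ∀ {s} → s ∈ filter (λ s → increasing s Bool.≟ true) (subseqs σ) → length s ≤ k
  go {s} s∈ with s∈′ , inc ← ∈-filter⁻ (λ s → increasing s Bool.≟ true) {xs = subseqs σ} s∈
    = bound (∈-subseqs⁻ s∈′) (increasing⁻ s (Equivalence.from T-≡ inc))

S312⁺ : ∀ n τ {σ} → IsPerm n σ → Avoids312 σ → T (avoids τ σ) → σ ∈ S312 n τ
S312⁺ n τ {σ} p av av′ = ∈-filter⁺ (λ σ → (avoids p312 σ ∧ avoids τ σ) Bool.≟ true) (perms⁺ p)
  (Equivalence.to T-≡ (Equivalence.from T-∧ (avoids-p312⁺ σ av , av′)))

S312⁻ : ∀ n τ {σ} → σ ∈ S312 n τ → IsPerm n σ × Avoids312 σ × T (avoids τ σ)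
S312⁻ n τ {σ} σ∈
  with p , eq ← ∈-filter⁻ (λ σ → (avoids p312 σ ∧ avoids τ σ) Bool.≟ true) {xs = perms n} σ∈
  with av , av′ ← Equivalence.to (T-∧ {avoids p312 σ}) (Equivalence.from T-≡ eq)
  = perms⁻ p , avoids-p312⁻ σ av , av′

S312-Unique : ∀ n τ → Unique (S312 n τ)
S312-Unique n τ = Unique.filter⁺ (λ σ → (avoids p312 σ ∧ avoids τ σ) Bool.≟ true) (perms-Unique n)

-- The generating tree

State : Set
State = List ℕ × List ℕ

flat : State → List ℕ
flat (p , d) = p ++ d

up : ℕ → State → State
up v (p , d) = p , v ∷ d

-- The insertions of `v` that leave a nonempty prefix of `d` before it. The empty prefix is left to
-- `up`, because only there the longest increasing subsequence does not grow.
drops : ℕ → List ℕ → List ℕ → List State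
drops v p []      = []
drops v p (x ∷ d) = (p ++ [ x ] , v ∷ d) ∷ drops v (p ++ [ x ]) d

children : ℕ → State → List State
children v (p , d) = drops v p d

-- G n q lists the splittings σ = p ++ d of the 312-avoiding permutations of {0,…,n} with
-- longest increasing subsequence of length q + 1, where d starts at the maximum n.
G : ℕ → ℕ → List State
G zero    zero    = [ [] , [ 0 ] ]
G zero    (suc q) = []
G (suc n) zero    = map (up (suc n)) (G n zero)
G (suc n) (suc q) =
  map (up (suc n)) (G n (suc q)) ++ concatMap (children (suc n)) (G n q)

drops⁺ : ∀ v p x e {d} → (p ++ x ∷ e , v ∷ d) ∈ drops v p (x ∷ e ++ d)
drops⁺ v p x []      = here refl
drops⁺ v p x (y ∷ e) {d} = there (subst (λ z → (z , v ∷ d) ∈ drops v (p ++ [ x ]) (y ∷ e ++ d))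
  (List.++-assoc p [ x ] (y ∷ e)) (drops⁺ v (p ++ [ x ]) y e))

drops⁻ : ∀ v p d {u} → u ∈ drops v p d →
  ∃₂ λ x e → ∃ λ d′ → d ≡ x ∷ e ++ d′ × u ≡ (p ++ x ∷ e , v ∷ d′)
drops⁻ v p (x ∷ d) (here refl) = x , [] , d , refl , refl
drops⁻ v p (x ∷ d) (there u∈) with y , e , d′ , refl , refl ← drops⁻ v (p ++ [ x ]) d u∈
  = x , y ∷ e , d′ , refl , cong (_, v ∷ d′) (List.++-assoc p [ x ] (y ∷ e))

length-drops : ∀ v p d → length (drops v p d) ≡ length d
length-drops v p []      = refl
length-drops v p (x ∷ d) = cong suc (length-drops v (p ++ [ x ]) d)

-- By the place of `n` in a supposed 312: absent, the triple is an old one; first, the other two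
-- ascend inside the decreasing `ys`; second or third, `n` would lie below another entry.
Avoids312-insert : ∀ xs → Avoids312 (xs ++ ys) → Decreasing ys → All (_<ₙ n) (xs ++ ys) →
  Avoids312 (xs ++ n ∷ ys)
Avoids312-insert {ys} xs av dec <n sub b<c c<a with ⊆-++⁻ xs sub
... | s₁ , s₂ , eq , sub₁ , _ ∷ʳ sub₂ =
  av (subst (_⊆ xs ++ ys) (sym eq) (⊆-++⁺ sub₁ sub₂)) b<c c<a
... | [] , _ , refl , _ , refl ∷ sub₂ with (c<b ∷ _) ∷ _ ← AllPairs-resp-⊆ sub₂ dec =
  ℕ.<-asym b<c c<b
... | _ ∷ [] , _ , refl , _ , refl ∷ sub₂ with c<n ∷ _ ← All-resp-⊆ sub₂ (All.++⁻ʳ xs <n) =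
  ℕ.<-asym b<c c<n
... | _ ∷ _ ∷ [] , _ , refl , sub₁ , refl ∷ _ with a<n ∷ _ ← All-resp-⊆ sub₁ (All.++⁻ˡ xs <n) =
  ℕ.<-asym c<a a<n
... | _ ∷ _ ∷ _ ∷ [] , _ , () , _ , refl ∷ _

-- An increasing subsequence of p ++ d has at most one term in the decreasing d, and the
-- maximum n at the head of d extends any one of p: bounded and attained pin LIS to q + 1.
record Inv (n q : ℕ) (u : State) : Set where
  field
    perm     : IsPerm (suc n) (flat u)
    avoid    : Avoids312 (flat u)
    dec      : Decreasing (proj₂ u)
    head     : ∃ λ e → proj₂ u ≡ n ∷ e
    bounded  : ∀ {s} → s ⊆ proj₁ u → Increasing s → length s ≤ q
    attained : ∃ λ s → s ⊆ proj₁ u × Increasing s × length s ≡ q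

open Inv

Inv-left< : ∀ {u} → Inv n q u → All (_<ₙ n) (proj₁ u)
Inv-left< {u = p , _} inv with _ , refl ← head inv = All.++⁻ˡ p (perm-< (perm-delete p (perm inv)))

Increasing∧Decreasing⇒length≤1 : Increasing xs → Decreasing xs → length xs ≤ 1
Increasing∧Decreasing⇒length≤1 []                []                = z≤n
Increasing∧Decreasing⇒length≤1 ([] ∷ _)          _                 = s≤s z≤n
Increasing∧Decreasing⇒length≤1 ((x<y ∷ _) ∷ _) ((y<x ∷ _) ∷ _) = ⊥-elim (ℕ.<-asym x<y y<x)

bounded-++ : ∀ {p d} → (∀ {s} → s ⊆ p → Increasing s → length s ≤ q) → Decreasing d →
  ∀ {s} → s ⊆ p ++ d → Increasing s → length s ≤ suc q
bounded-++ {q} {p} bound dec sub inc with s₁ , s₂ , refl , sub₁ , sub₂ ← ⊆-++⁻ p sub = begin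
  length (s₁ ++ s₂)     ≡⟨ List.length-++ s₁ ⟩
  length s₁ + length s₂ ≤⟨ ℕ.+-mono-≤ (bound sub₁ (AllPairs-resp-⊆ (++⁺ʳ s₂ ⊆-refl) inc))
                             (Increasing∧Decreasing⇒length≤1 (AllPairs-resp-⊆ (++⁺ˡ s₁ ⊆-refl) inc)
                               (AllPairs-resp-⊆ sub₂ dec)) ⟩
  q + 1                 ≡⟨ ℕ.+-comm q 1 ⟩
  suc q                 ∎
  where open ≤-Reasoning

attained-++ : ∀ {u} → Inv n q u → ∃ λ s → s ⊆ proj₁ u ++ [ n ] × Increasing s × length s ≡ suc q
attained-++ {n} {u = p , _} inv with s , sub , inc , refl ← attained inv =
  s ++ [ n ] , ⊆-++⁺ sub ⊆-refl ,
  AllPairs.++⁺ inc ([] ∷ []) (All.map (_∷ []) (All-resp-⊆ sub (Inv-left< inv))) ,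
  trans (List.length-++ s) (ℕ.+-comm (length s) 1)

Inv-up : ∀ {u} → Inv n q u → Inv (suc n) q (up (suc n) u)
Inv-up {u = p , d} inv = record
  { perm     = perm-insert p (perm inv)
  ; avoid    = Avoids312-insert p (avoid inv) (dec inv) (perm-< (perm inv))
  ; dec      = All.++⁻ʳ p (perm-< (perm inv)) ∷ dec inv
  ; head     = d , refl
  ; bounded  = bounded inv
  ; attained = attained inv
  }

-- The moved block `x ∷ e` is decreasing, so it raises the bound by at most one. It starts with the
-- old maximum, which extends every increasing subsequence of `p`, so the new bound is attained.
Inv-drop : ∀ p x e d → Inv n q (p , x ∷ e ++ d) → Inv (suc n) (suc q) (p ++ x ∷ e , suc n ∷ d)
Inv-drop {n} p x e d inv = record
  { perm     = perm-insert (p ++ x ∷ e) perm′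
  ; avoid    = Avoids312-insert (p ++ x ∷ e) (subst Avoids312 assoc (avoid inv)) dec′ (perm-< perm′)
  ; dec      = All.++⁻ʳ (p ++ x ∷ e) (perm-< perm′) ∷ dec′
  ; head     = d , refl
  ; bounded  = bounded-++ (bounded inv) (AllPairs-resp-⊆ (++⁺ʳ d ⊆-refl) (dec inv))
  ; attained = attained′
  }
  where
  assoc : p ++ x ∷ e ++ d ≡ (p ++ x ∷ e) ++ d
  assoc = sym (List.++-assoc p (x ∷ e) d)
  perm′ = subst (IsPerm (suc n)) assoc (perm inv)
  dec′ : Decreasing d
  dec′ = AllPairs-resp-⊆ (++⁺ˡ (x ∷ e) ⊆-refl) (dec inv)
  attained′ : ∃ λ s → s ⊆ p ++ x ∷ e × Increasing s × length s ≡ suc _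
  -- Matching on `head inv` identifies `x` with the old maximum `n`.
  attained′ with _ , refl ← head inv with s , sub , rest ← attained-++ inv
    = s , ⊆-trans sub (⊆-++⁺ (⊆-refl {x = p}) (refl ∷ minimum e)) , rest

G-Inv : ∀ n q {u} → u ∈ G n q → Inv n q u
G-Inv zero zero (here refl) = record
  { perm     = ↭-refl
  ; avoid    = λ { (refl ∷ ()) ; (_ ∷ʳ ()) }
  ; dec      = [] ∷ []
  ; head     = [] , refl
  ; bounded  = λ { [] _ → z≤n }
  ; attained = [] , [] , [] , refl
  }
G-Inv (suc n) zero u∈ with _ , u′∈ , refl ← ∈-map⁻ _ u∈ = Inv-up (G-Inv n zero u′∈)
G-Inv (suc n) (suc q) u∈ with ∈-++⁻ (map (up (suc n)) (G n (suc q))) u∈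
... | inj₁ u∈ups with _ , u′∈ , refl ← ∈-map⁻ _ u∈ups = Inv-up (G-Inv n (suc q) u′∈)
... | inj₂ u∈drops
  with (p , d) , u′∈ , u∈ ← find (∈-concatMap⁻ (children (suc n)) {xs = G n q} u∈drops)
  with x , e , d′ , refl , refl ← drops⁻ (suc n) p d u∈ = Inv-drop p x e d′ (G-Inv n q u′∈)

LIS-G : ∀ n q {u} → u ∈ G n q → LIS (flat u) ≡ suc q
LIS-G n q {p , d} u∈ with inv ← G-Inv n q u∈ with e , refl ← head inv
  with s , sub , inc , len ← attained-++ inv = ℕ.≤-antisym
    (LIS≤ (p ++ d) (bounded-++ (bounded inv) (dec inv)))
    (subst (_≤ LIS (p ++ d)) len (length≤LIS (⊆-trans sub (⊆-++⁺ (⊆-refl {x = p}) (refl ∷ minimum _))) inc))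

-- Locates the cut made by deleting a maximum relative to the start of the decreasing tail.
++-compare : ∀ (xs : List A) {ys} us {vs} → xs ++ ys ≡ us ++ vs →
  (∃ λ w → us ≡ xs ++ w × ys ≡ w ++ vs) ⊎ (∃₂ λ x w → xs ≡ us ++ x ∷ w × vs ≡ x ∷ w ++ ys)
++-compare []       us       eq = inj₁ (us , refl , eq)
++-compare (x ∷ xs) []       eq = inj₂ (x , xs , refl , sym eq)
++-compare (x ∷ xs) (u ∷ us) eq with refl , eq′ ← List.∷-injective eq with ++-compare xs us eq′
... | inj₁ (w , refl , e)     = inj₁ (w , refl , e)
... | inj₂ (y , w , refl , e) = inj₂ (y , w , refl , e)

-- An ascent to the right of the maximum would form a 312 with it; distinctness makes the descents
-- strict.
Avoids312⇒tail-Decreasing : ∀ xs ys → Avoids312 (xs ++ n ∷ ys) → IsPerm (suc n) (xs ++ n ∷ ys) →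
  Decreasing ys
Avoids312⇒tail-Decreasing {n} xs ys av p = go ys (λ sub → av (++⁺ˡ xs (refl ∷ sub)))
  (All.++⁻ʳ xs (perm-< (perm-delete xs p)))
  (AllPairs-resp-⊆ (++⁺ˡ xs (n ∷ʳ ⊆-refl)) (Unique-resp-↭ (↭⇒↭ₛ (↭-sym p)) (Unique.downFrom⁺ (suc n))))
  where
  go : ∀ ys → (∀ {b c} → b ∷ c ∷ [] ⊆ ys → b <ₙ c → c <ₙ n → ⊥) → All (_<ₙ n) ys →
    Unique ys → Decreasing ys
  go []       _ _          _          = []
  go (y ∷ ys) f (_ ∷ ys<) (y≢ ∷ u) =
    All.tabulate (λ z∈ → ℕ.≤∧≢⇒< (ℕ.≮⇒≥ (λ y<z → f (refl ∷ from∈ z∈) y<z (All.lookup ys< z∈)))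
      (All.lookup y≢ z∈ ∘ sym)) ∷ go ys (f ∘ (y ∷ʳ_)) ys< u

-- Deleting the maximum leaves a 312-avoiding permutation, which is in the tree by induction. The
-- place of the deleted entry then decides whether `σ` arises by `up` or by a drop.
G-complete : ∀ n {σ} → IsPerm (suc n) σ → Avoids312 σ → ∃₂ λ q u → u ∈ G n q × flat u ≡ σ
G-complete zero    p av with refl ← ↭-singleton-inv p = 0 , _ , here refl , refl
G-complete (suc n) p av with xs , ys , refl ← ∈-∃++ (∈-resp-↭ (↭-sym p) (here refl))
  with dec-ys ← Avoids312⇒tail-Decreasing xs ys av p
  with q , (p′ , d) , u∈ , eq ← G-complete n (perm-delete xs p)
         (λ sub → av (⊆-trans sub (⊆-++⁺ (⊆-refl {x = xs}) (suc n ∷ʳ ⊆-refl))))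
  with ++-compare p′ xs eq
... | inj₁ ([] , refl , refl) = q , _ , up∈ q u∈ , cong (_++ suc n ∷ d) (sym (List.++-identityʳ p′))
  where
  up∈ : ∀ q {u} → u ∈ G n q → up (suc n) u ∈ G (suc n) q
  up∈ zero    u∈ = ∈-map⁺ _ u∈
  up∈ (suc q) u∈ = ∈-++⁺ˡ (∈-map⁺ _ u∈)
... | inj₁ (x ∷ e , refl , refl) = suc q , _ ,
  ∈-++⁺ʳ (map (up (suc n)) (G n (suc q)))
    (∈-concatMap⁺ (children (suc n)) (lose u∈ (drops⁺ (suc n) p′ x e))) , refl
-- The maximum cannot have stood inside `p′`: what follows it would decrease, yet contain `x` from
-- `p′` before the larger `n` at the head of `d`.
... | inj₂ (x , w , refl , refl) with inv ← G-Inv n q u∈ with _ , refl ← head inv with x> ∷ _ ← dec-ys =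
  ⊥-elim (ℕ.<-asym (All.lookup x> (∈-++⁺ʳ w (here refl)))
    (All.lookup (Inv-left< inv) (∈-++⁺ʳ xs (here refl))))

-- Counting

-- A left inverse to inserting the maximum `n`: it recovers the parent of a child, so distinctness
-- passes from parents to children.
erase : ℕ → List ℕ → List ℕ
erase n = filter (ℕ._<? n)

erase-insert : ∀ xs {ys} → All (_<ₙ n) (xs ++ ys) → erase n (xs ++ n ∷ ys) ≡ xs ++ ys
erase-insert {n} xs {ys} <n = begin
  erase n (xs ++ n ∷ ys)          ≡⟨ List.filter-++ (ℕ._<? n) xs (n ∷ ys) ⟩
  erase n xs ++ erase n (n ∷ ys)  ≡⟨ cong₂ _++_ (List.filter-all (ℕ._<? n) (All.++⁻ˡ xs <n))
                                       (trans (List.filter-reject (ℕ._<? n) (ℕ.<-irrefl refl))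
                                         (List.filter-all (ℕ._<? n) (All.++⁻ʳ xs <n))) ⟩
  xs ++ ys                        ∎
  where open ≡-Reasoning

erase-up : ∀ {u} → Inv n q u → erase (suc n) (flat (up (suc n) u)) ≡ flat u
erase-up {u = p , _} inv = erase-insert p (perm-< (perm inv))

erase-drop : ∀ {p d u} → Inv n q (p , d) → u ∈ drops (suc n) p d → erase (suc n) (flat u) ≡ p ++ d
erase-drop {n} {p = p} {d} inv u∈ with x , e , d′ , refl , refl ← drops⁻ (suc n) p d u∈ =
  trans (erase-insert (p ++ x ∷ e) (perm-< (perm-delete (p ++ x ∷ e) (perm (Inv-drop p x e d′ inv)))))
        (List.++-assoc p (x ∷ e) d′)

-- The first child and any later one agree on `p ++ [ x ]`; the next entry is `v` in the first and
-- an entry of `d`, below `v`, in the other.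
drops-Unique : ∀ v p d → All (_<ₙ v) d → Unique (map flat (drops v p d))
drops-Unique v p []      _          = []
drops-Unique v p (x ∷ d) (_ ∷ <v) =
  All.map⁺ (All.tabulate distinct) ∷ drops-Unique v (p ++ [ x ]) d <v
  where
  distinct : ∀ {u} → u ∈ drops v (p ++ [ x ]) d → (p ++ [ x ]) ++ v ∷ d ≢ flat u
  distinct u∈ eq with y , e , d′ , refl , refl ← drops⁻ v (p ++ [ x ]) d u∈
    with refl ← List.∷-injectiveˡ (List.++-cancelˡ (p ++ [ x ]) _ _
                  (trans eq (List.++-assoc (p ++ [ x ]) (y ∷ e) (v ∷ d′)))) = ℕ.<-irrefl refl (All.head <v)

AllPairs-map-All : ∀ {P : A → Set ℓ} {R S : Rel A ℓ} → (∀ {x y} → P x → P y → R x y → S x y) →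
  All P xs → AllPairs R xs → AllPairs S xs
AllPairs-map-All f []         []         = []
AllPairs-map-All f (px ∷ pxs) (rx ∷ rxs) =
  All.zipWith (λ (py , r) → f px py r) (pxs , rx) ∷ AllPairs-map-All f pxs rxs

ups-Unique : ∀ n q → Unique (map flat (G n q)) → Unique (map flat (map (up (suc n)) (G n q)))
ups-Unique n q u = Unique.map⁻ (subst Unique (sym eq) u)
  where
  open ≡-Reasoning
  eq : map (erase (suc n)) (map flat (map (up (suc n)) (G n q))) ≡ map flat (G n q)
  eq = begin
    map (erase (suc n)) (map flat (map (up (suc n)) (G n q)))   ≡⟨ List.map-∘ (map (up (suc n)) (G n q)) ⟨
    map (erase (suc n) ∘ flat) (map (up (suc n)) (G n q))       ≡⟨ List.map-∘ (G n q) ⟨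
    map (erase (suc n) ∘ flat ∘ up (suc n)) (G n q)
      ≡⟨ List.map-cong-local (All.tabulate (erase-up ∘ G-Inv n q)) ⟩
    map flat (G n q)                                            ∎

-- `erase` separates children of different parents, and `drops-Unique` those of one parent. An `up`
-- child and a drop cannot coincide, since erasing would give one parent with two values of `LIS`.
G-Unique : ∀ n q → Unique (map flat (G n q))
G-Unique zero    zero    = [] ∷ []
G-Unique zero    (suc q) = []
G-Unique (suc n) zero    = ups-Unique n zero (G-Unique n zero)
G-Unique (suc n) (suc q) = subst Unique (sym (List.map-++ flat (map (up (suc n)) (G n (suc q))) _))
  (Unique.++⁺ (ups-Unique n (suc q) (G-Unique n (suc q))) drops′ ups-drops)
  where
  invs : All (Inv n q) (G n q)
  invs = All.tabulate (G-Inv n q)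

  siblings : ∀ {u u′} → Inv n q u → Inv n q u′ → flat u ≢ flat u′ →
    Disjoint (map flat (children (suc n) u)) (map flat (children (suc n) u′))
  siblings inv inv′ u≢u′ (x∈ , x∈′)
    with _ , y∈ , refl ← ∈-map⁻ flat x∈ with _ , y∈′ , eq ← ∈-map⁻ flat x∈′
    = u≢u′ (trans (sym (erase-drop inv y∈)) (trans (cong (erase (suc n)) eq) (erase-drop inv′ y∈′)))

  drops′ : Unique (map flat (concatMap (children (suc n)) (G n q)))
  drops′ = subst Unique (sym (List.map-concatMap flat (children (suc n)) (G n q)))
    (Unique.concat⁺
      (All.map⁺ (All.map (λ {u} inv → drops-Unique (suc n) (proj₁ u) (proj₂ u)
                                         (All.++⁻ʳ (proj₁ u) (perm-< (perm inv)))) invs))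
      (AllPairs.map⁺ (AllPairs-map-All siblings invs (AllPairs.map⁻ (G-Unique n q)))))

  ups-drops : Disjoint (map flat (map (up (suc n)) (G n (suc q))))
                       (map flat (concatMap (children (suc n)) (G n q)))
  ups-drops (x∈ , x∈′)
    with _ , y∈ , refl ← ∈-map⁻ flat x∈ with _ , z∈ , refl ← ∈-map⁻ (up (suc n)) y∈
    with _ , y∈′ , eq ← ∈-map⁻ flat x∈′
    with _ , z∈′ , w∈ ← find (∈-concatMap⁻ (children (suc n)) {xs = G n q} y∈′)
    = ℕ.1+n≢n (trans (sym (LIS-G n (suc q) z∈)) (trans (cong LIS parents) (LIS-G n q z∈′)))
    where
    parents = trans (sym (erase-up (G-Inv n (suc q) z∈)))
      (trans (cong (erase (suc n)) eq) (erase-drop (G-Inv n q z∈′) w∈))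

-- Recurrences and polynomial bounds.

g W : ℕ → ℕ → ℕ
g n q = length (G n q)
W n q = sum (map (length ∘ proj₂) (G n q))

g-suc : ∀ n q → g (suc n) (suc q) ≡ g n (suc q) + W n q
g-suc n q = begin
  length (map (up (suc n)) (G n (suc q)) ++ concatMap (children (suc n)) (G n q))
    ≡⟨ List.length-++ (map (up (suc n)) (G n (suc q))) ⟩
  length (map (up (suc n)) (G n (suc q))) + length (concatMap (children (suc n)) (G n q))
    ≡⟨ cong₂ _+_ (List.length-map (up (suc n)) (G n (suc q)))
         (trans (length-concatMap (children (suc n)) (G n q))
           (cong sum (List.map-cong (λ (p , d) → length-drops (suc n) p d) (G n q)))) ⟩
  g n (suc q) + W n q ∎
  where open ≡-Reasoning

-- Only the children made by `up` are counted: each has a tail one longer than its parent's, which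
-- contributes the `g n q`.
W-suc : ∀ n q → g n q + W n q ≤ W (suc n) q
W-suc n q = ≤-trans (ℕ.≤-reflexive (ups (G n q))) (⊆G q)
  where
  ups : ∀ us → length us + sum (map (length ∘ proj₂) us) ≡
               sum (map (length ∘ proj₂) (map (up (suc n)) us))
  ups []             = refl
  ups ((p , d) ∷ us) = cong suc (begin
    length us + (length d + sum (map (length ∘ proj₂) us)) ≡⟨ ℕ.+-assoc (length us) _ _ ⟨
    length us + length d + sum (map (length ∘ proj₂) us)   ≡⟨ cong (_+ sum (map (length ∘ proj₂) us)) (ℕ.+-comm (length us) _) ⟩
    length d + length us + sum (map (length ∘ proj₂) us)   ≡⟨ ℕ.+-assoc (length d) _ _ ⟩
    length d + (length us + sum (map (length ∘ proj₂) us)) ≡⟨ cong (_+_ (length d)) (ups us) ⟩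
    length d + sum (map (length ∘ proj₂) (map (up (suc n)) us)) ∎)
    where open ≡-Reasoning
  ⊆G : ∀ q → sum (map (length ∘ proj₂) (map (up (suc n)) (G n q))) ≤ W (suc n) q
  ⊆G zero    = ≤-refl
  ⊆G (suc q) rewrite List.map-++ (length ∘ proj₂) (map (up (suc n)) (G n (suc q)))
                       (concatMap (children (suc n)) (G n q))
                   | sum-++ (map (length ∘ proj₂) (map (up (suc n)) (G n (suc q))))
                       (map (length ∘ proj₂) (concatMap (children (suc n)) (G n q)))
             = ℕ.m≤m+n _ _

-- The factor `k` on the left replaces a division: it is `1` for `W` and for `LIS`, and `suc n` for
-- the sum of the lower levels of `g`.
*-sum-bound : ∀ k {b} (f : A → ℕ) {xs} → All (λ x → k * f x ≤ b) xs →
  k * sum (map f xs) ≤ length xs * b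
*-sum-bound k f []       = ℕ.≤-reflexive (ℕ.*-zeroʳ k)
*-sum-bound k f (_∷_ {x} {xs} fx fxs) = ≤-trans
  (ℕ.≤-reflexive (ℕ.*-distribˡ-+ k (f x) (sum (map f xs))))
  (ℕ.+-mono-≤ fx (*-sum-bound k f fxs))

W≤ : ∀ n q → W n q ≤ g n q * suc n
W≤ n q = subst (_≤ g n q * suc n) (ℕ.*-identityˡ _)
  (*-sum-bound 1 (length ∘ proj₂) (All.tabulate
    (λ u∈ → ≤-trans (ℕ.≤-reflexive (ℕ.*-identityˡ _)) (short u∈))))
  where
  short : ∀ {u} → u ∈ G n q → length (proj₂ u) ≤ suc n
  short {p , d} u∈ = begin
    length d            ≤⟨ ℕ.m≤n+m (length d) (length p) ⟩
    length p + length d ≡⟨ List.length-++ p ⟨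
    length (p ++ d)     ≡⟨ perm-length (perm (G-Inv n q u∈)) ⟩
    suc n               ∎
    where open ≤-Reasoning

-- Induction on `n`. With `X` the square of n+1, the recurrence gives at most X^q (X + n + 1) = X^q
-- (n+1)(n+2), and each factor n+1 is then raised to n+2.
g-upper : ∀ n q → g n q ≤ (suc n * suc n) ^ q
g-upper zero    zero    = ≤-refl
g-upper zero    (suc q) = z≤n
g-upper (suc n) zero    = subst (_≤ 1) (sym (List.length-map _ (G n zero))) (g-upper n zero)
g-upper (suc n) (suc q) = begin
  g (suc n) (suc q)                     ≡⟨ g-suc n q ⟩
  g n (suc q) + W n q
    ≤⟨ ℕ.+-mono-≤ (g-upper n (suc q)) (≤-trans (W≤ n q) (ℕ.*-monoˡ-≤ (suc n) (g-upper n q))) ⟩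
  X * X ^ q + X ^ q * suc n             ≡⟨ cong (_+ X ^ q * suc n) (ℕ.*-comm X (X ^ q)) ⟩
  X ^ q * X + X ^ q * suc n             ≡⟨ ℕ.*-distribˡ-+ (X ^ q) X (suc n) ⟨
  X ^ q * (X + suc n)
    ≡⟨ cong (X ^ q *_) (trans (ℕ.+-comm X (suc n)) (sym (ℕ.*-suc (suc n) (suc n)))) ⟩
  X ^ q * (suc n * suc (suc n))
    ≤⟨ ℕ.*-mono-≤ (ℕ.^-monoˡ-≤ q (ℕ.*-mono-≤ n≤ n≤)) (ℕ.*-monoˡ-≤ (suc (suc n)) n≤) ⟩
  (suc (suc n) * suc (suc n)) ^ q * (suc (suc n) * suc (suc n))
    ≡⟨ ℕ.*-comm ((suc (suc n) * suc (suc n)) ^ q) _ ⟩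
  (suc (suc n) * suc (suc n)) ^ suc q   ∎
  where
  open ≤-Reasoning
  X = suc n * suc n
  n≤ : suc n ≤ suc (suc n)
  n≤ = ℕ.n≤1+n (suc n)

-- A discrete integration: from `N` on, each of `j` steps adds at least `l`.
linear-growth : ∀ N l (f : ℕ → ℕ) → (∀ {n} → N ≤ n → l + f n ≤ f (suc n)) →
  ∀ j {n} → N + j ≤ n → j * l ≤ f n
linear-growth N l f step zero    _ = z≤n
linear-growth N l f step (suc j) {zero}  le with () ← subst (_≤ 0) (ℕ.+-suc N j) le
linear-growth N l f step (suc j) {suc n} le =
  ≤-trans (ℕ.+-monoʳ-≤ l (linear-growth N l f step j le′)) (step (≤-trans (ℕ.m≤m+n N j) le′))
  where
  le′ : N + j ≤ n
  le′ = ℕ.≤-pred (subst (_≤ suc n) (ℕ.+-suc N j) le)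

-- Each level integrates twice: `h` steps after the bound for `g n q` starts to hold, `W n q` has
-- gained a factor `h`, and `h` steps later `g n (suc q)` has gained another. Hence the waiting time
-- `h + h` per level.
g-lower : ∀ h q {n} → q * (h + h) ≤ n → (h * h) ^ q ≤ g n q
g-lower h zero    {zero}  _ = ≤-refl
g-lower h zero    {suc n} _ = subst (1 ≤_) (sym (List.length-map _ (G n zero))) (g-lower h zero {n} z≤n)
g-lower h (suc q) {n} le = subst (_≤ g n (suc q)) (sym (ℕ.*-assoc h h _))
  (linear-growth (N + h) (h * (h * h) ^ q) (λ n → g n (suc q)) step h (subst (_≤ n) eq le))
  where
  N = q * (h + h)
  eq : suc q * (h + h) ≡ N + h + h
  eq = trans (ℕ.+-comm (h + h) N) (sym (ℕ.+-assoc N h h))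
  step : ∀ {n} → N + h ≤ n → h * (h * h) ^ q + g n (suc q) ≤ g (suc n) (suc q)
  step {n} le = begin
    h * (h * h) ^ q + g n (suc q) ≤⟨ ℕ.+-monoˡ-≤ (g n (suc q))
      (linear-growth N ((h * h) ^ q) (λ n → W n q)
        (λ {n} le → ≤-trans (ℕ.+-monoˡ-≤ (W n q) (g-lower h q le)) (W-suc n q)) h le) ⟩
    W n q + g n (suc q)           ≡⟨ ℕ.+-comm (W n q) _ ⟩
    g n (suc q) + W n q           ≡⟨ g-suc n q ⟨
    g (suc n) (suc q)             ∎
    where open ≤-Reasoning

-- An entry above `c` pays its own share `suc c`; every other entry is charged in full to the
-- filtered list. With `LIS` for `f` this bounds the mean from below.
sum-deficit : ∀ c (f : A → ℕ) xs →
  suc c * length xs ≤ sum (map f xs) + suc c * length (filter (λ x → f x ≤? c) xs)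
sum-deficit c f [] = ≤-refl
sum-deficit c f (x ∷ xs) with f x ≤? c
... | yes fx≤c rewrite List.filter-accept (λ x → f x ≤? c) {xs = xs} fx≤c = begin
  suc c * suc (length xs)         ≡⟨ ℕ.*-suc (suc c) (length xs) ⟩
  suc c + suc c * length xs       ≤⟨ ℕ.+-monoʳ-≤ (suc c) (sum-deficit c f xs) ⟩
  suc c + (Σf + suc c * l)        ≡⟨ ℕ.+-comm (suc c) _ ⟩
  Σf + suc c * l + suc c          ≡⟨ ℕ.+-assoc Σf _ _ ⟩
  Σf + (suc c * l + suc c)        ≤⟨ ℕ.+-mono-≤ (ℕ.m≤n+m Σf (f x))
                                    (ℕ.≤-reflexive (trans (ℕ.+-comm (suc c * l) (suc c))
                                                          (sym (ℕ.*-suc (suc c) l)))) ⟩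
  f x + Σf + suc c * suc l        ∎
  where
  open ≤-Reasoning
  Σf = sum (map f xs)
  l = length (filter (λ x → f x ≤? c) xs)
... | no fx≰c rewrite List.filter-reject (λ x → f x ≤? c) {xs = xs} fx≰c = begin
  suc c * suc (length xs)         ≡⟨ ℕ.*-suc (suc c) (length xs) ⟩
  suc c + suc c * length xs       ≤⟨ ℕ.+-mono-≤ (ℕ.≰⇒> fx≰c) (sum-deficit c f xs) ⟩
  f x + (Σf + suc c * l)          ≡⟨ ℕ.+-assoc (f x) Σf _ ⟨
  f x + Σf + suc c * l            ∎
  where
  open ≤-Reasoning
  Σf = sum (map f xs)
  l = length (filter (λ x → f x ≤? c) xs)

^-distrib-* : ∀ m n k → (m * n) ^ k ≡ m ^ k * n ^ k
^-distrib-* m n zero    = refl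
^-distrib-* m n (suc k) = trans (cong (_*_ (m * n)) (^-distrib-* m n k))
  (ℕ.[m*n]*[o*p]≡[m*o]*[n*p] m n (m ^ k) (n ^ k))

-- Rarity of permutations with a short longest increasing subsequence.

module _ (c : ℕ) where

  -- Here `c` is m - 2, so the limit m - 1 is `suc c`. The size is `suc n`, as for `G n q`.
  S : ℕ → List (List ℕ)
  S n = S312 (suc n) (incr (2 + c))

  short : ℕ → List (List ℕ)
  short n = filter (λ σ → LIS σ ≤? c) (S n)

  LIS≤1+c : ∀ n → All (λ σ → LIS σ ≤ suc c) (S n)
  LIS≤1+c n = All.tabulate (λ {σ} σ∈ → LIS≤ σ (λ sub inc →
    ℕ.≤-pred (avoids-incr⁻ (2 + c) σ (proj₂ (proj₂ (S312⁻ (suc n) (incr (2 + c)) σ∈))) sub inc)))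

  -- The top level `c` alone has the full order of growth; its members have `LIS` equal to `suc c`,
  -- still below m.
  g≤length-S : ∀ n → g n c ≤ length (S n)
  g≤length-S n = subst (_≤ length (S n)) (List.length-map flat (G n c))
    (Unique∧⊆⇒length≤ (G-Unique n c) sub)
    where
    sub : ∀ {σ} → σ ∈ map flat (G n c) → σ ∈ S n
    sub σ∈ with (p , d) , u∈ , refl ← ∈-map⁻ flat σ∈ with inv ← G-Inv n c u∈ =
      S312⁺ (suc n) (incr (2 + c)) (perm inv) (avoid inv)
        (avoids-incr⁺ (2 + c) (p ++ d) (λ sub inc → s≤s (bounded-++ (bounded inv) (dec inv) sub inc)))

  -- A short permutation occurs in the tree at some level `q`, where `LIS` is `suc q`; hence `q` is
  -- below `c`.
  length-short≤ : ∀ n → length (short n) ≤ sum (map (g n) (upTo c))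
  length-short≤ n = subst (length (short n) ≤_)
    (trans (length-concatMap (map flat ∘ G n) (upTo c))
      (cong sum (List.map-cong (λ q → List.length-map flat (G n q)) (upTo c))))
    (Unique∧⊆⇒length≤ (Unique.filter⁺ (λ σ → LIS σ ≤? c) (S312-Unique (suc n) (incr (2 + c)))) sub)
    where
    sub : ∀ {σ} → σ ∈ short n → σ ∈ concatMap (map flat ∘ G n) (upTo c)
    sub σ∈ with σ∈S , LIS≤c ← ∈-filter⁻ (λ σ → LIS σ ≤? c) {xs = S n} σ∈
      with p , av , _ ← S312⁻ (suc n) (incr (2 + c)) σ∈S
      with q , _ , u∈ , refl ← G-complete n p av
      = ∈-concatMap⁺ (map flat ∘ G n)
          (lose (∈-upTo⁺ (subst (_≤ c) (LIS-G n q u∈) LIS≤c)) (∈-map⁺ flat u∈))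

  n*length-short≤ : ∀ n → suc n * length (short n) ≤ c * (suc n * suc n) ^ c
  n*length-short≤ n = ≤-trans (ℕ.*-monoʳ-≤ (suc n) (length-short≤ n))
    (subst (λ l → suc n * sum (map (g n) (upTo c)) ≤ l * X ^ c) (List.length-upTo c)
      (*-sum-bound (suc n) (g n) (All.map term (All.all-upTo c))))
    where
    X = suc n * suc n
    term : ∀ {q} → q <ₙ c → suc n * g n q ≤ X ^ c
    -- The missing level is worth a whole factor `X`, which absorbs `suc n`.
    term {q} q<c = ≤-trans (ℕ.*-mono-≤ (ℕ.m≤m*n (suc n) (suc n)) (g-upper n q)) (ℕ.^-monoʳ-≤ X q<c)

  -- D = 2c + 1 instead of 2c, so that h = n / D makes sense also for c = 0; the lower bound
  -- for g applies since 2ch ≤ n.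
  D E K : ℕ
  D = suc (c * 2)
  E = D + D
  K = c * (E * E) ^ c

  -- With `h` the quotient of `n` by `D`, n + 1 is at most D + Dh, and `h ≥ 1` turns this into Eh;
  -- the doubling in `E` pays for the remainder. The bound `g-lower` at `h` then applies.
  n^2c≤g : ∀ n → D ≤ n → (suc n * suc n) ^ c ≤ (E * E) ^ c * g n c
  n^2c≤g n D≤n = begin
    (suc n * suc n) ^ c           ≤⟨ ℕ.^-monoˡ-≤ c (ℕ.*-mono-≤ 1+n≤Eh 1+n≤Eh) ⟩
    (E * h * (E * h)) ^ c         ≡⟨ cong (_^ c) (ℕ.[m*n]*[o*p]≡[m*o]*[n*p] E h E h) ⟩
    (E * E * (h * h)) ^ c         ≡⟨ ^-distrib-* (E * E) (h * h) c ⟩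
    (E * E) ^ c * (h * h) ^ c     ≤⟨ ℕ.*-monoʳ-≤ ((E * E) ^ c) (g-lower h c c*2h≤n) ⟩
    (E * E) ^ c * g n c           ∎
    where
    open ≤-Reasoning
    h = n ℕ./ D
    h≥1 : 1 ≤ h
    h≥1 = ℕ.m≥n⇒m/n>0 D≤n
    c*2h≤n : c * (h + h) ≤ n
    c*2h≤n = begin
      c * (h + h)     ≡⟨ cong (λ k → c * (h + k)) (ℕ.+-identityʳ h) ⟨
      c * (2 * h)     ≡⟨ ℕ.*-assoc c 2 h ⟨
      c * 2 * h       ≤⟨ ℕ.m≤n+m (c * 2 * h) h ⟩
      D * h           ≡⟨ ℕ.*-comm D h ⟩
      h * D           ≤⟨ ℕ.m/n*n≤m n D ⟩
      n               ∎
    1+n≤Eh : suc n ≤ E * h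
    1+n≤Eh = begin
      suc n                   ≡⟨ cong suc (ℕ.m≡m%n+[m/n]*n n D) ⟩
      suc (n ℕ.% D) + h * D   ≤⟨ ℕ.+-mono-≤ (ℕ.m%n<n n D) (ℕ.≤-reflexive (ℕ.*-comm h D)) ⟩
      D + D * h               ≡⟨ cong (_+ D * h) (ℕ.*-identityʳ D) ⟨
      D * 1 + D * h           ≤⟨ ℕ.+-monoˡ-≤ (D * h) (ℕ.*-monoʳ-≤ D h≥1) ⟩
      D * h + D * h           ≡⟨ ℕ.*-distribʳ-+ h D D ⟨
      E * h                   ∎

  n*length-short≤K*length-S : ∀ n → D ≤ n → suc n * length (short n) ≤ K * length (S n)
  n*length-short≤K*length-S n D≤n = begin
    suc n * length (short n)      ≤⟨ n*length-short≤ n ⟩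
    c * (suc n * suc n) ^ c       ≤⟨ ℕ.*-monoʳ-≤ c (n^2c≤g n D≤n) ⟩
    c * ((E * E) ^ c * g n c)     ≡⟨ ℕ.*-assoc c ((E * E) ^ c) (g n c) ⟨
    K * g n c                     ≤⟨ ℕ.*-monoʳ-≤ K (g≤length-S n) ⟩
    K * length (S n)              ∎
    where open ≤-Reasoning

  length-S>0 : ∀ n → D ≤ n → 0 <ₙ length (S n)
  length-S>0 n D≤n = ≤-trans (ℕ.n≢0⇒n>0 nonzero) (g≤length-S n)
    where
    nonzero : g n c ≢ 0
    nonzero eq = ℕ.<-irrefl refl (begin-strict
      0                       <⟨ ℕ.m^n>0 (suc n * suc n) c ⟩
      (suc n * suc n) ^ c     ≤⟨ n^2c≤g n D≤n ⟩
      (E * E) ^ c * g n c     ≡⟨ cong (_*_ ((E * E) ^ c)) eq ⟩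
      (E * E) ^ c * 0         ≡⟨ ℕ.*-zeroʳ ((E * E) ^ c) ⟩
      0                       ∎)
      where open ≤-Reasoning

  -- Both sides are multiplied by `suc K`. Using `suc K` instead of `K` leaves a spare copy of
  -- `length (S n)`, whose positivity makes the inequality strict.
  few-short : ∀ q n → D ≤ n → q * suc K ≤ n → q * length (short n) <ₙ length (S n)
  few-short q n D≤n qK≤n = ℕ.*-cancelˡ-< (suc K) _ _ (begin-strict
    suc K * (q * length (short n))  ≡⟨ ℕ.*-assoc (suc K) q _ ⟨
    suc K * q * length (short n)    ≡⟨ cong (_* length (short n)) (ℕ.*-comm (suc K) q) ⟩
    q * suc K * length (short n)    ≤⟨ ℕ.*-monoˡ-≤ (length (short n)) (ℕ.m≤n⇒m≤1+n qK≤n) ⟩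
    suc n * length (short n)        ≤⟨ n*length-short≤K*length-S n D≤n ⟩
    K * length (S n)                <⟨ ℕ.m<n+m (K * length (S n)) (length-S>0 n D≤n) ⟩
    suc K * length (S n)            ∎)
    where open ≤-Reasoning

-- From natural-number bounds to rationals.

toℚᵘ-/ : ∀ k d → toℚᵘ (+ k / suc d) ℚᵘ.≃ mkℚᵘ (+ k) d
toℚᵘ-/ k d = ℚ.toℚᵘ-fromℚᵘ (mkℚᵘ (+ k) d)

-- The normalised mean is at most 1 and falls short of it by at most b/(a+1), which is below the
-- reciprocal of the denominator of `ε`; a positive `ε` is at least that reciprocal.
mean-close : ∀ {S a b c} ε → 0ℚ < ε → S ≤ suc a * suc c → suc c * suc a ≤ S + suc c * b →
  ℚ.denominatorℕ ε * b <ₙ suc a →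
  ∣ (+ S / 1) ℚ.* (+ 1 / suc a) ℚ.* (+ 1 / suc c) - 1ℚ ∣ < ε
mean-close (mkℚ (+ zero) q _) (ℚ.*<* (+<+ ()))
mean-close (mkℚ -[1+ _ ] q _) (ℚ.*<* ())
mean-close {S} {a} {b} {c} ε@(mkℚ (+ suc p) q _) _ upper lower small =
  ℚ.toℚᵘ-cancel-< (ℚᵘ.<-respˡ-≃ (ℚᵘ.≃-sym toU) (*<* bound))
  where
  open ℕ.≤-Reasoning
  -- Chosen so that `suc k` is `suc a * suc c` by computation, the denominator of the combined
  -- fraction.
  k = c + a * suc c
  y = (+ S / 1) ℚ.* (+ 1 / suc a)
  U = mkℚᵘ (+ S) 0 ℚᵘ.* mkℚᵘ (+ 1) a ℚᵘ.* mkℚᵘ (+ 1) c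
  U≡ : U ≡ mkℚᵘ (+ S) k
  U≡ = cong₂ mkℚᵘ (trans (ℤ.*-identityʳ (+ S ℤ.* + 1)) (ℤ.*-identityʳ (+ S)))
                   (cong (λ a → c + a * suc c) (ℕ.+-identityʳ a))
  toU : toℚᵘ ∣ y ℚ.* (+ 1 / suc c) - 1ℚ ∣ ℚᵘ.≃ ℚᵘ.∣ mkℚᵘ (+ S) k ℚᵘ.- ℚᵘ.1ℚᵘ ∣
  toU = ℚᵘ.≃-trans (ℚ.toℚᵘ-homo-∣-∣ (y ℚ.* (+ 1 / suc c) - 1ℚ))
    (ℚᵘ.∣-∣-cong (ℚᵘ.≃-trans (ℚ.toℚᵘ-homo-+ (y ℚ.* (+ 1 / suc c)) (ℚ.- 1ℚ))
      (ℚᵘ.+-congˡ (ℚᵘ.- ℚᵘ.1ℚᵘ)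
        (ℚᵘ.≃-trans (ℚ.toℚᵘ-homo-* y (+ 1 / suc c))
          (ℚᵘ.≃-trans (ℚᵘ.*-cong (ℚᵘ.≃-trans (ℚ.toℚᵘ-homo-* (+ S / 1) (+ 1 / suc a))
                                    (ℚᵘ.*-cong (toℚᵘ-/ S 0) (toℚᵘ-/ 1 a))) (toℚᵘ-/ 1 c))
            (ℚᵘ.≃-reflexive U≡))))))
  numerator : ∀ m → S ≤ m → ℤ.∣ + S ℤ.* + 1 ℤ.+ -[1+ 0 ] ℤ.* + m ∣ ≡ m ∸ S
  numerator m S≤m = trans
    (cong ℤ.∣_∣ (trans (cong₂ ℤ._+_ (ℤ.*-identityʳ (+ S)) (ℤ.-1*i≡-i (+ m))) (ℤ.m-n≡m⊖n S m)))
    (ℤ.∣⊖∣-≤ S≤m)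
  deficit : (suc k ∸ S) * suc q <ₙ suc p * (suc k * 1)
  deficit = begin-strict
    (suc k ∸ S) * suc q          ≤⟨ ℕ.*-monoˡ-≤ (suc q) (ℕ.m≤n+o⇒m∸n≤o (suc k) S
                                      (subst (_≤ S + suc c * b) (ℕ.*-comm (suc c) (suc a)) lower)) ⟩
    suc c * b * suc q            ≡⟨ ℕ.*-assoc (suc c) b (suc q) ⟩
    suc c * (b * suc q)          ≡⟨ cong (suc c *_) (ℕ.*-comm b (suc q)) ⟩
    suc c * (suc q * b)          <⟨ ℕ.*-monoʳ-< (suc c) small ⟩
    suc c * suc a                ≡⟨ ℕ.*-comm (suc c) (suc a) ⟩
    suc k                        ≡⟨ ℕ.*-identityʳ (suc k) ⟨
    suc k * 1                    ≤⟨ ℕ.m≤m+n (suc k * 1) (p * (suc k * 1)) ⟩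
    suc p * (suc k * 1)          ∎
  bound : + ℤ.∣ + S ℤ.* + 1 ℤ.+ -[1+ 0 ] ℤ.* + suc k ∣ ℤ.* + suc q ℤ.< + suc p ℤ.* + (suc k * 1)
  bound = subst₂ ℤ._<_
    (trans (ℤ.pos-* (suc k ∸ S) (suc q)) (cong (λ z → + z ℤ.* + suc q) (sym (numerator (suc k) upper))))
    (ℤ.pos-* (suc p) (suc k * 1)) (+<+ deficit)

theorem3p2 : (m : ℕ) → 2 ≤ m → (ε : ℚ) → 0ℚ < ε →
    ∃ λ (N : ℕ) → (n : ℕ) → N ≤ n →
    ∣ divℕ (expLIS (incr m) n) (m ∸ 1) - 1ℚ ∣ < ε
-- `D c` admits the lower bound for `g`, `b * suc (K c)` admits `few-short`, and the outer `suc`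
-- matches the shift between `n` and the size.
theorem3p2 (suc (suc c)) (s≤s (s≤s z≤n)) ε ε>0 = suc (D c + b * suc (K c)) , close
  where
  b = ℚ.denominatorℕ ε
  close : ∀ n → suc (D c + b * suc (K c)) ≤ n →
    ∣ divℕ (expLIS (incr (2 + c)) n) (suc c) - 1ℚ ∣ < ε
  close (suc n) (s≤s N≤n)
    -- Abstracting the length lets `divℕ` reduce; length zero is excluded by the strict inequality
    -- of `few-short`.
    with length (S c n)
       | *-sum-bound 1 LIS (All.map (≤-trans (ℕ.≤-reflexive (ℕ.*-identityˡ _))) (LIS≤1+c c n))
       | sum-deficit c LIS (S c n)
       | few-short c b n (≤-trans (ℕ.m≤m+n (D c) _) N≤n) (≤-trans (ℕ.m≤n+m _ (D c)) N≤n)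
  ... | suc a | upper | lower | few =
    mean-close ε ε>0 (subst (_≤ suc a * suc c) (ℕ.*-identityˡ _) upper) lower few
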